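{- There is no functional $\Theta$ satisfying $\textsf{SFF}(\Theta)$ that is computable in $\exists^2$.
   Context: The metatheory is $\textsf{ZFC}$ and functionals live in the full (set-theoretic) type structure over $\mathbb{N}$. "Computable" (in given functionals) means Kleene computable via the schemes S1–S9. For $f\in\mathbb{N}^{\mathbb{N}}$, $\overline{f}N=\langle f(0),\dots,f(N-1)\rangle$; for a finite sequence $\sigma$, $f\in[\sigma]$ means $f$ extends $\sigma$. A functional $\Theta$ of type $2\to1^*$ assigns to every $G:\mathbb{N}^{\mathbb{N}}\to\mathbb{N}$ a finite sequence $\Theta(G)=\langle f_0,\dots,f_k\rangle$ of elements of $\mathbb{N}^{\mathbb{N}}$. $\textsf{SFF}(\Theta)$ ("$\Theta$ is a special fan functional") is the statement: for all $G:\mathbb{N}^{\mathbb{N}}\to\mathbb{N}$ and all $f\in2^{\mathbb{N}}$ there is an entry $g$ of $\Theta(G)$ with $f\in[\overline{g}G(g)]$. That such a $\Theta$ is computable means that the (suitably coded) map giving the length of $\Theta(G)$ and the values $\Theta(G)(i)(n)$ is computable. $\exists^2:\mathbb{N}^{\mathbb{N}}\to\{0,1\}$ is the functional with $\exists^2(f)=0$ if and only if $(\exists n)(f(n)=0)$. -}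

module Defs where

open import Data.Fin.Base using (toℕ)
open import Data.List.Base using (List; []; _∷_; _++_; length; take; applyUpTo)
open import Data.List.Membership.Propositional using (_∈_)
open import Data.List.Relation.Unary.All as All using (All; []; _∷_)
open import Data.List.Relation.Unary.All.Properties using (++⁺; ─⁺; take⁺)
open import Data.List.Relation.Unary.Any using (index; _─_)
open import Data.Nat.Base using (ℕ; zero; suc; _+_; _*_; _^_; _≤_; _<_)
open import Data.Product.Base using (∃; ∃-syntax; _×_)
open import Data.Sum.Base using (_⊎_)
open import Function.Bundles using (_⇔_)
open import Relation.Binary.PropositionalEquality using (_≡_)

-- The pure types: 0 is ℕ, and k + 1 is k → 0.  Under excluded middle and
-- function extensionality these function spaces are the full
-- set-theoretic ones.
Tp : ℕ → Set
Tp zero    = ℕ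
Tp (suc k) = Tp k → ℕ

-- A bijective coding of finite sequences of numbers:
-- ⟨⟩ = 0 and ⟨x₀, x₁, …, xₙ⟩ = 2^x₀ · (2 · ⟨x₁, …, xₙ⟩ + 1).
⟨_⟩ : List ℕ → ℕ
⟨ [] ⟩     = 0
⟨ x ∷ xs ⟩ = 2 ^ x * suc (2 * ⟨ xs ⟩)

-- Kleene's S1–S9.  Comp σ e as y says that {e}(as) is defined with value
-- y, for a list as of arguments of the pure types listed in σ.
--
-- S6 moves the argument at an arbitrary position to the front; iterating
-- it gives every permutation of the arguments.
-- In S8 the premise for every ξ makes the oracle call defined only if
-- λξ.{d}(ξ, α, as) is total.
-- S9 passes on the first m of the arguments following the index z.
data Comp : (σ : List ℕ) → ℕ → All Tp σ → ℕ → Set where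

  S1 : ∀ {σ} (x : ℕ) (as : All Tp σ) →
       Comp (0 ∷ σ) ⟨ 1 ∷ [] ⟩ (x ∷ as) (suc x)

  S2 : ∀ {σ} (q : ℕ) (as : All Tp σ) →
       Comp σ ⟨ 2 ∷ q ∷ [] ⟩ as q

  S3 : ∀ {σ} (x : ℕ) (as : All Tp σ) →
       Comp (0 ∷ σ) ⟨ 3 ∷ [] ⟩ (x ∷ as) x

  S4 : ∀ {σ} {e d x y : ℕ} {as : All Tp σ} →
       Comp σ d as x →
       Comp (0 ∷ σ) e (x ∷ as) y →
       Comp σ ⟨ 4 ∷ e ∷ d ∷ [] ⟩ as y

  S5-zero : ∀ {σ} {e d y : ℕ} {as : All Tp σ} →
            Comp σ e as y →
            Comp (0 ∷ σ) ⟨ 5 ∷ e ∷ d ∷ [] ⟩ (zero ∷ as) y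

  S5-suc : ∀ {σ} {e d x y z : ℕ} {as : All Tp σ} →
           Comp (0 ∷ σ) ⟨ 5 ∷ e ∷ d ∷ [] ⟩ (x ∷ as) y →
           Comp (0 ∷ 0 ∷ σ) d (x ∷ y ∷ as) z →
           Comp (0 ∷ σ) ⟨ 5 ∷ e ∷ d ∷ [] ⟩ (suc x ∷ as) z

  S6 : ∀ {σ k} {e y : ℕ} {as : All Tp σ} (p : k ∈ σ) →
       Comp (k ∷ (σ ─ p)) e (All.lookup as p ∷ ─⁺ p as) y →
       Comp σ ⟨ 6 ∷ e ∷ toℕ (index p) ∷ [] ⟩ as y

  S7 : ∀ {σ} (f : Tp 1) (x : ℕ) (as : All Tp σ) →
       Comp (1 ∷ 0 ∷ σ) ⟨ 7 ∷ [] ⟩ (f ∷ x ∷ as) (f x)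

  S8 : ∀ {σ k} {d : ℕ} {α : Tp (2 + k)} {as : All Tp σ} (χ : Tp (1 + k)) →
       (∀ (ξ : Tp k) → Comp (k ∷ 2 + k ∷ σ) d (ξ ∷ α ∷ as) (χ ξ)) →
       Comp (2 + k ∷ σ) ⟨ 8 ∷ d ∷ [] ⟩ (α ∷ as) (α χ)

  S9 : ∀ {σ} {z y m : ℕ} {as : All Tp σ} →
       m ≤ length σ →
       Comp (take m σ) z (take⁺ m as) y →
       Comp (0 ∷ σ) ⟨ 9 ∷ m ∷ [] ⟩ (z ∷ as) y

ComputableIn : ∀ {σ ρ} → (All Tp σ → ℕ) → All Tp ρ → Set
ComputableIn {σ} {ρ} Ψ Φs =
  ∃[ e ] ∀ (as : All Tp σ) → Comp (σ ++ ρ) e (++⁺ as Φs) (Ψ as)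

-- A finite sequence ⟨f₀, …, fₖ⟩ as a single map: the value at (0, n) is
-- the length, the value at (i + 1, n) is fᵢ(n), and 0 if there is no fᵢ.
seqMap : List (Tp 1) → ℕ → ℕ → ℕ
seqMap fs zero    n = length fs
seqMap fs (suc i) n = value fs i
  where
  value : List (Tp 1) → ℕ → ℕ
  value []       _       = 0
  value (f ∷ _)  zero    = f n
  value (_ ∷ fs) (suc i) = value fs i

codedMap : (Tp 2 → List (Tp 1)) → All Tp (2 ∷ 0 ∷ 0 ∷ []) → ℕ
codedMap Θ (G ∷ i ∷ n ∷ []) = seqMap (Θ G) i n

bar : Tp 1 → ℕ → List ℕ
bar f N = applyUpTo f N

infix 4 _∈[_]

_∈[_] : Tp 1 → List ℕ → Set
f ∈[ s ] = bar f (length s) ≡ s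

Binary : Tp 1 → Set
Binary f = ∀ n → f n < 2

SFF : (Tp 2 → List (Tp 1)) → Set
SFF Θ = ∀ (G : Tp 2) (f : Tp 1) → Binary f →
        ∃[ g ] (g ∈ Θ G × f ∈[ bar g (G g) ])

-- The defining property of ∃², which determines E up to extensionality.
Is∃² : Tp 2 → Set
Is∃² E = ∀ (f : Tp 1) →
         (E f ≡ 0 ⊎ E f ≡ 1) × (E f ≡ 0 ⇔ (∃ λ n → f n ≡ 0))

-- Answer a query χ by (the successor of) a code of a program computing χ.
-- Such an oracle is built in transfinitely many stages: a partial oracle U
-- is sound if each value U(χ) = c is a program computing χ from every total
-- extension of U, and a sound U is enlarged by one program for each function
-- computable from U outside its domain.  At a fixed point U every function
-- computable from a total extension G of U is already in the domain of U,
-- because a computation only queries functions it computes.  Distinct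
-- functions have distinct programs, so f(c) ≠ χ(c) whenever U(χ) = c defines
-- a binary f; as G(χ) = c + 1 for such χ, no entry of Θ(G) covers f.
module Submission where

open import Defs
open import Axiom.ExcludedMiddle using (ExcludedMiddle)
open import Axiom.Extensionality.Propositional using (Extensionality)
open import Data.Bool.Base using (Bool; true; false)
open import Data.Empty using (⊥-elim)
open import Data.Fin.Base using (toℕ)
open import Data.List.Base using (List; []; _∷_; length; take; applyUpTo)
open import Data.List.Membership.Propositional using (_∈_)
open import Data.List.Properties using (∷-injective; ∷-injectiveʳ; length-applyUpTo)
open import Data.List.Relation.Unary.All as All using (All; []; _∷_)
open import Data.List.Relation.Unary.All.Properties using (lookup-map; ─⁺; take⁺)
open import Data.List.Relation.Unary.Any using (here; there; index; _─_)
open import Data.Nat.Base using (ℕ; zero; suc; _+_; _*_; _^_; _<_; z≤n; s≤s)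
open import Data.Nat.Properties
  using (even≢odd; suc-injective; *-assoc; *-cancelˡ-≡; *-identityˡ; n<1+n)
open import Data.Product.Base using (Σ-syntax; ∃; _×_; _,_; proj₁; proj₂)
open import Data.Sum.Base using (_⊎_; inj₁; inj₂)
open import Level using (0ℓ)
open import Relation.Binary.PropositionalEquality
  using (_≡_; _≢_; refl; sym; trans; cong; cong₂; subst)
open import Relation.Nullary.Decidable.Core using (yes; no; does)
open import Relation.Nullary.Negation.Core using (¬_)

-- Injectivity of the coding of sequences

-- Unequal exponents of 2 would, after cancelling, equate an even and an odd number.
pair-injective : ∀ x y {m n} → 2 ^ x * suc (2 * m) ≡ 2 ^ y * suc (2 * n) → x ≡ y × m ≡ n
pair-injective zero zero {m} {n} eq =
  refl , *-cancelˡ-≡ m n 2 (suc-injective (trans (sym (*-identityˡ _)) (trans eq (*-identityˡ _))))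
pair-injective zero (suc y) {m} {n} eq =
  ⊥-elim (even≢odd (2 ^ y * suc (2 * n)) m
    (trans (sym (*-assoc 2 (2 ^ y) _)) (trans (sym eq) (*-identityˡ _))))
pair-injective (suc x) zero {m} {n} eq =
  ⊥-elim (even≢odd (2 ^ x * suc (2 * m)) n
    (trans (sym (*-assoc 2 (2 ^ x) _)) (trans eq (*-identityˡ _))))
pair-injective (suc x) (suc y) eq
  with refl , m≡n ← pair-injective x y
         (*-cancelˡ-≡ _ _ 2 (trans (sym (*-assoc 2 (2 ^ x) _)) (trans eq (*-assoc 2 (2 ^ y) _))))
  = refl , m≡n

pair≢0 : ∀ x m → 2 ^ x * suc m ≢ 0
pair≢0 zero    m ()
pair≢0 (suc x) m eq = pair≢0 x m (*-cancelˡ-≡ _ 0 2 (trans (sym (*-assoc 2 (2 ^ x) _)) eq))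

⟨⟩-injective : ∀ xs ys → ⟨ xs ⟩ ≡ ⟨ ys ⟩ → xs ≡ ys
⟨⟩-injective []       []       eq = refl
⟨⟩-injective []       (y ∷ ys) eq = ⊥-elim (pair≢0 y _ (sym eq))
⟨⟩-injective (x ∷ xs) []       eq = ⊥-elim (pair≢0 x _ eq)
⟨⟩-injective (x ∷ xs) (y ∷ ys) eq with x≡y , eq′ ← pair-injective x y eq =
  cong₂ _∷_ x≡y (⟨⟩-injective xs ys eq′)

-- Inversion and determinism of computations

-- The possible last steps of a computation, indexed by the decoded program
-- so that programs of different schemes do not unify.
data LastStep : (σ : List ℕ) → List ℕ → All Tp σ → ℕ → Set where
  S1 : ∀ {σ x} {as : All Tp σ} → LastStep (0 ∷ σ) (1 ∷ []) (x ∷ as) (suc x)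
  S2 : ∀ {σ q} {as : All Tp σ} → LastStep σ (2 ∷ q ∷ []) as q
  S3 : ∀ {σ x} {as : All Tp σ} → LastStep (0 ∷ σ) (3 ∷ []) (x ∷ as) x
  S4 : ∀ {σ e d x y} {as : All Tp σ} → Comp σ d as x → Comp (0 ∷ σ) e (x ∷ as) y →
       LastStep σ (4 ∷ e ∷ d ∷ []) as y
  S5-zero : ∀ {σ e d y} {as : All Tp σ} → Comp σ e as y →
            LastStep (0 ∷ σ) (5 ∷ e ∷ d ∷ []) (zero ∷ as) y
  S5-suc : ∀ {σ e d x y z} {as : All Tp σ} → Comp (0 ∷ σ) ⟨ 5 ∷ e ∷ d ∷ [] ⟩ (x ∷ as) y →
           Comp (0 ∷ 0 ∷ σ) d (x ∷ y ∷ as) z →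
           LastStep (0 ∷ σ) (5 ∷ e ∷ d ∷ []) (suc x ∷ as) z
  S6 : ∀ {σ k e y i} {as : All Tp σ} (p : k ∈ σ) → i ≡ toℕ (index p) →
       Comp (k ∷ (σ ─ p)) e (All.lookup as p ∷ ─⁺ p as) y →
       LastStep σ (6 ∷ e ∷ i ∷ []) as y
  S7 : ∀ {σ f x} {as : All Tp σ} → LastStep (1 ∷ 0 ∷ σ) (7 ∷ []) (f ∷ x ∷ as) (f x)
  S8 : ∀ {σ k d α} {as : All Tp σ} (χ : Tp (1 + k)) →
       (∀ ξ → Comp (k ∷ 2 + k ∷ σ) d (ξ ∷ α ∷ as) (χ ξ)) →
       LastStep (2 + k ∷ σ) (8 ∷ d ∷ []) (α ∷ as) (α χ)
  S9 : ∀ {σ z y m} {as : All Tp σ} → Comp (take m σ) z (take⁺ m as) y →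
       LastStep (0 ∷ σ) (9 ∷ m ∷ []) (z ∷ as) y

-- Codes are numbers built by arithmetic and do not unify, so the code enters through an equation,
-- which `⟨⟩-injective` turns into one between lists.
lastStep : ∀ {σ e as y} → Comp σ e as y → ∀ l → e ≡ ⟨ l ⟩ → LastStep σ l as y
lastStep (S1 x as)       l eq with refl ← ⟨⟩-injective (1 ∷ []) l eq = S1
lastStep (S2 q as)       l eq with refl ← ⟨⟩-injective (2 ∷ q ∷ []) l eq = S2
lastStep (S3 x as)       l eq with refl ← ⟨⟩-injective (3 ∷ []) l eq = S3
lastStep (S4 {e = e} {d} a b) l eq with refl ← ⟨⟩-injective (4 ∷ e ∷ d ∷ []) l eq = S4 a b
lastStep (S5-zero {e = e} {d} a) l eq with refl ← ⟨⟩-injective (5 ∷ e ∷ d ∷ []) l eq = S5-zero a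
lastStep (S5-suc {e = e} {d} a b) l eq with refl ← ⟨⟩-injective (5 ∷ e ∷ d ∷ []) l eq = S5-suc a b
lastStep (S6 {e = e} p a) l eq with refl ← ⟨⟩-injective (6 ∷ e ∷ toℕ (index p) ∷ []) l eq = S6 p refl a
lastStep (S7 f x as)     l eq with refl ← ⟨⟩-injective (7 ∷ []) l eq = S7
lastStep (S8 {d = d} χ a) l eq with refl ← ⟨⟩-injective (8 ∷ d ∷ []) l eq = S8 χ a
lastStep (S9 {m = m} _ a) l eq with refl ← ⟨⟩-injective (9 ∷ m ∷ []) l eq = S9 a

-- An S6 code stores only a number, which has to determine the type moved to the front as well as
-- the position.
index-injective : ∀ {j k : ℕ} {σ} (p : j ∈ σ) (q : k ∈ σ) → toℕ (index p) ≡ toℕ (index q) →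
                  _≡_ {A = ∃ (_∈ σ)} (j , p) (k , q)
index-injective (here refl) (here refl) eq = refl
index-injective (there p)   (there q)   eq with refl ← index-injective p q (suc-injective eq) = refl

Comp-deterministic : Extensionality 0ℓ 0ℓ → ∀ {σ e as y y′} →
                     Comp σ e as y → Comp σ e as y′ → y ≡ y′
Comp-deterministic ext = det
  where
  det : ∀ {σ e as y y′} → Comp σ e as y → Comp σ e as y′ → y ≡ y′
  det (S1 x as) c with lastStep c (1 ∷ []) refl
  ... | S1 = refl
  det (S2 q as) c with lastStep c (2 ∷ q ∷ []) refl
  ... | S2 = refl
  det (S3 x as) c with lastStep c (3 ∷ []) refl
  ... | S3 = refl
  det (S4 {e = e} {d} a b) c with lastStep c (4 ∷ e ∷ d ∷ []) refl
  ... | S4 a′ b′ with refl ← det a a′ = det b b′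
  det (S5-zero {e = e} {d} a) c with lastStep c (5 ∷ e ∷ d ∷ []) refl
  ... | S5-zero a′ = det a a′
  det (S5-suc {e = e} {d} a b) c with lastStep c (5 ∷ e ∷ d ∷ []) refl
  ... | S5-suc a′ b′ with refl ← det a a′ = det b b′
  det (S6 {e = e} p a) c with lastStep c (6 ∷ e ∷ toℕ (index p) ∷ []) refl
  ... | S6 q eq a′ with refl ← index-injective p q eq = det a a′
  det (S7 f x as) c with lastStep c (7 ∷ []) refl
  ... | S7 = refl
  -- The induction hypothesis makes the two queries equal only pointwise.
  det (S8 {d = d} {α} χ a) c with lastStep c (8 ∷ d ∷ []) refl
  ... | S8 χ′ a′ = cong α (ext λ ξ → det (a ξ) (a′ ξ))
  det (S9 {m = m} _ a) c with lastStep c (9 ∷ m ∷ []) refl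
  ... | S9 a′ = det a a′

-- Coded programs with named oracles

-- Argument lists of programs that refer to a variable oracle (var) and to
-- the fixed functional (fix).
data Arg : ℕ → Set where
  num : ℕ → Arg 0
  var : Arg 2
  fix : Arg 2

-- Numbers are shifted past the two marks for the oracles, so that decoding is unambiguous.
argCodes : ∀ {σ} → All Arg σ → List ℕ
argCodes []          = []
argCodes (num x ∷ t) = suc (suc x) ∷ argCodes t
argCodes (var ∷ t)   = 0 ∷ argCodes t
argCodes (fix ∷ t)   = 1 ∷ argCodes t

parse : List ℕ → ∃ (All Arg)
parse []                = _ , []
parse (0 ∷ l)           = _ , var ∷ proj₂ (parse l)
parse (1 ∷ l)           = _ , fix ∷ proj₂ (parse l)
parse (suc (suc x) ∷ l) = _ , num x ∷ proj₂ (parse l)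

parse-argCodes : ∀ {σ} (t : All Arg σ) → parse (argCodes t) ≡ (σ , t)
parse-argCodes []          = refl
parse-argCodes (num x ∷ t) rewrite parse-argCodes t = refl
parse-argCodes (var ∷ t)   rewrite parse-argCodes t = refl
parse-argCodes (fix ∷ t)   rewrite parse-argCodes t = refl

-- The oracle is named rather than stored, so an index together with its parameters fits into one
-- number.
code : ∀ {σ} → ℕ → All Arg σ → ℕ
code d t = ⟨ d ∷ argCodes t ⟩

code-injective : ∀ {σ σ′} d d′ (t : All Arg σ) (t′ : All Arg σ′) → code d t ≡ code d′ t′ →
                 d ≡ d′ × _≡_ {A = ∃ (All Arg)} (σ , t) (σ′ , t′)
code-injective d d′ t t′ eq with d≡d′ , eq′ ← ∷-injective (⟨⟩-injective _ _ eq) =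
  d≡d′ , trans (sym (parse-argCodes t)) (trans (cong parse eq′) (parse-argCodes t′))

map-─⁺ : ∀ {P Q : ℕ → Set} {σ k} (f : ∀ {k} → P k → Q k) (t : All P σ) (p : k ∈ σ) →
         ─⁺ p (All.map f t) ≡ All.map f (─⁺ p t)
map-─⁺ f (_ ∷ t) (here _)  = refl
map-─⁺ f (a ∷ t) (there p) = cong (f a ∷_) (map-─⁺ f t p)

map-take⁺ : ∀ {P Q : ℕ → Set} {σ} (f : ∀ {k} → P k → Q k) (t : All P σ) m →
            take⁺ m (All.map f t) ≡ All.map f (take⁺ m t)
map-take⁺ f t       zero    = refl
map-take⁺ f []      (suc m) = refl
map-take⁺ f (a ∷ t) (suc m) = cong (f a ∷_) (map-take⁺ f t m)

seqMap-∈ : ∀ {g fs} → g ∈ fs → ∃ λ i → ∀ n → seqMap fs (suc i) n ≡ g n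
seqMap-∈ (here refl) = 0 , λ _ → refl
-- The local function of seqMap ignores the list and index it was lifted
-- over, so the values at (f ∷ fs, i + 2) and (fs, i + 1) are convertible.
seqMap-∈ (there g∈fs) with i , eq ← seqMap-∈ g∈fs = suc i , eq

applyUpTo-injective : ∀ {f g : ℕ → ℕ} n → applyUpTo f n ≡ applyUpTo g n →
                      ∀ {i} → i < n → f i ≡ g i
applyUpTo-injective (suc n) eq {zero}  _         = proj₁ (∷-injective eq)
applyUpTo-injective (suc n) eq {suc i} (s≤s i<n) = applyUpTo-injective n (∷-injectiveʳ eq) i<n

∈[bar]⇒agree : ∀ {f g : Tp 1} n → f ∈[ bar g n ] → ∀ {i} → i < n → f i ≡ g i
∈[bar]⇒agree {f} {g} n eq =
  applyUpTo-injective n (trans (cong (bar f) (sym (length-applyUpTo g n))) eq)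

-- Subsets and the Bourbaki-Witt fixed point

module Classical (em : ExcludedMiddle 0ℓ) (ext : Extensionality 0ℓ 0ℓ) where

  -- With booleans in place of propositions, the power set of a type in Set
  -- stays in Set, and so does the impredicative Tower.
  ⌊_⌋ : Set → Bool
  ⌊ P ⌋ = does (em {P})

  ⌊⌋-sound : ∀ {P} → ⌊ P ⌋ ≡ true → P
  ⌊⌋-sound {P} eq with em {P}
  ... | yes p = p

  ⌊⌋-complete : ∀ {P} → P → ⌊ P ⌋ ≡ true
  ⌊⌋-complete {P} p with em {P}
  ... | yes _ = refl
  ... | no ¬p = ⊥-elim (¬p p)

  Subset : Set → Set
  Subset A = A → Bool

  infix 4 _∋_ _⊑_

  _∋_ : ∀ {A} → Subset A → A → Set
  S ∋ a = S a ≡ true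

  _⊑_ : ∀ {A} → Subset A → Subset A → Set
  S ⊑ T = ∀ {a} → S ∋ a → T ∋ a

  ⊑-antisym : ∀ {A} {S T : Subset A} → S ⊑ T → T ⊑ S → S ≡ T
  ⊑-antisym {S = S} {T} S⊑T T⊑S = ext pointwise
    where
    pointwise : ∀ a → S a ≡ T a
    pointwise a with S a in s | T a in t
    ... | true  | true  = refl
    ... | false | false = refl
    ... | true  | false = trans (sym (S⊑T s)) t
    ... | false | true  = trans (sym s) (T⊑S t)

  ⋃ : ∀ {A} → Subset (Subset A) → Subset A
  ⋃ D a = ⌊ ∃ (λ S → D ∋ S × S ∋ a) ⌋

  ∈⇒⊑⋃ : ∀ {A} {D : Subset (Subset A)} {S} → D ∋ S → S ⊑ ⋃ D
  ∈⇒⊑⋃ S∈D a∈S = ⌊⌋-complete (_ , S∈D , a∈S)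

  -- The proof of the Bourbaki–Witt theorem: the least family closed under
  -- next and unions is a chain, and its union is a fixed point of next.
  module Iteration {A : Set} (next : Subset A → Subset A) (inflationary : ∀ {S} → S ⊑ next S) where

    data Tower : Subset A → Set where
      step  : ∀ {S} → Tower S → Tower (next S)
      union : ∀ {D} → (∀ S → D ∋ S → Tower S) → Tower (⋃ D)

    -- The extreme points of the Bourbaki-Witt proof: the two inclusion conditions make `T` a proper
    -- subset of `S`.
    Extremal : Subset A → Set
    Extremal S = ∀ {T} → Tower T → T ⊑ S → ¬ (S ⊑ T) → next T ⊑ S

    extremal-comparable : ∀ {S T} → Extremal S → Tower T → T ⊑ S ⊎ next S ⊑ T
    extremal-comparable {S} extS (step {T} towerT) with extremal-comparable extS towerT
    ... | inj₂ nextS⊑T = inj₂ λ a∈ → inflationary (nextS⊑T a∈)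
    ... | inj₁ T⊑S with em {S ⊑ T}
    ...   | no S⋢T = inj₁ (extS towerT T⊑S S⋢T)
    -- `next` is not assumed monotone, so mutual inclusion must first become equality.
    ...   | yes S⊑T with refl ← ⊑-antisym {S = T} {S} T⊑S S⊑T = inj₂ λ a∈ → a∈
    extremal-comparable {S} extS (union {D} towers) with em {∃ λ T → D ∋ T × next S ⊑ T}
    ... | yes (T , T∈D , nextS⊑T) = inj₂ λ a∈ → ∈⇒⊑⋃ {D = D} T∈D (nextS⊑T a∈)
    ... | no none = inj₁ λ a∈⋃ → below (⌊⌋-sound a∈⋃)
      where
      below : ∀ {a} → ∃ (λ T → D ∋ T × T ∋ a) → S ∋ a
      below (T , T∈D , a∈T) with extremal-comparable extS (towers T T∈D)
      ... | inj₁ T⊑S     = T⊑S a∈T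
      ... | inj₂ nextS⊑T = ⊥-elim (none (T , T∈D , nextS⊑T))

    -- Induction on `S`. A proper subset of a union fails to contain some member, and comparability
    -- places it below that member.
    extremal : ∀ {S} → Tower S → Extremal S
    extremal (step {S} towerS) {T} towerT T⊑nextS nextS⋢T
      with extremal-comparable (extremal towerS) towerT
    ... | inj₂ nextS⊑T = ⊥-elim (nextS⋢T nextS⊑T)
    ... | inj₁ T⊑S with em {S ⊑ T}
    ...   | no S⋢T = λ a∈ → inflationary (extremal towerS towerT T⊑S S⋢T a∈)
    ...   | yes S⊑T with refl ← ⊑-antisym {S = T} {S} T⊑S S⊑T = λ a∈ → a∈
    extremal (union {D} towers) {T} towerT T⊑⋃ ⋃⋢T with em {∃ λ S → D ∋ S × ¬ (S ⊑ T)}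
    ... | no none = ⊥-elim (⋃⋢T λ a∈⋃ → below (⌊⌋-sound a∈⋃))
      where
      below : ∀ {a} → ∃ (λ S → D ∋ S × S ∋ a) → T ∋ a
      below (S , S∈D , a∈S) with em {S ⊑ T}
      ... | yes S⊑T = S⊑T a∈S
      ... | no S⋢T  = ⊥-elim (none (S , S∈D , S⋢T))
    ... | yes (S , S∈D , S⋢T) with extremal-comparable (extremal (towers S S∈D)) towerT
    ...   | inj₁ T⊑S     = λ a∈ → ∈⇒⊑⋃ {D = D} S∈D (extremal (towers S S∈D) towerT T⊑S S⋢T a∈)
    ...   | inj₂ nextS⊑T = ⊥-elim (S⋢T λ a∈ → nextS⊑T (inflationary a∈))

    chain : ∀ {S T} → Tower S → Tower T → S ⊑ T ⊎ T ⊑ S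
    chain towerS towerT with extremal-comparable (extremal towerS) towerT
    ... | inj₁ T⊑S     = inj₂ T⊑S
    ... | inj₂ nextS⊑T = inj₁ λ a∈ → nextS⊑T (inflationary a∈)

    top : Subset A
    top = ⋃ (λ S → ⌊ Tower S ⌋)

    top-tower : Tower top
    top-tower = union λ S → ⌊⌋-sound

    -- `next top` is again in the tower, hence among the sets united in `top`.
    top-fixed : next top ⊑ top
    top-fixed = ∈⇒⊑⋃ {D = λ S → ⌊ Tower S ⌋} (⌊⌋-complete (step top-tower))

  -- Sound partial oracles

  module _ (E : Tp 2) where

    ⟦_⟧ : ∀ {k} → Arg k → Tp 2 → Tp k
    ⟦ num x ⟧ G = x
    ⟦ var ⟧   G = G
    ⟦ fix ⟧   G = E

    ⟦_⟧* : ∀ {σ} → All Arg σ → Tp 2 → All Tp σ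
    ⟦ t ⟧* G = All.map (λ a → ⟦ a ⟧ G) t

    PartialOracle : Set
    PartialOracle = Subset (Tp 1 × ℕ)

    Defined : PartialOracle → Tp 1 → Set
    Defined U χ = ∃ λ c → U ∋ (χ , c)

    -- The shift by one makes the neighbourhood of χ given by G χ contain
    -- the position c, at which the diagonal function differs from χ.
    _Extends_ : Tp 2 → PartialOracle → Set
    G Extends U = ∀ {χ c} → U ∋ (χ , c) → G χ ≡ suc c

    -- Quantifying over all total extensions lets a program remain correct when `U` grows.
    ComputesFrom : PartialOracle → ℕ → Tp 1 → Set
    ComputesFrom U c χ =
      ∃ λ σ → ∃ λ d → Σ[ t ∈ All Arg σ ]
        (c ≡ code d t × (∀ G → G Extends U → ∀ n → Comp (0 ∷ σ) d (n ∷ ⟦ t ⟧* G) (χ n)))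

    Computable : PartialOracle → Tp 1 → Set
    Computable U χ = ∃ λ c → ComputesFrom U c χ

    ComputesFrom-mono : ∀ {U V c χ} → U ⊑ V → ComputesFrom U c χ → ComputesFrom V c χ
    ComputesFrom-mono U⊑V (σ , d , t , eq , comp) =
      σ , d , t , eq , λ G ext′ → comp G (λ χ∈U → ext′ (U⊑V χ∈U))

    -- Since em is a function, it chooses one program for χ.
    New : PartialOracle → Tp 1 × ℕ → Set
    New U (χ , c) = ¬ Defined U χ × Σ[ h ∈ ComputesFrom U c χ ] (em {Computable U χ} ≡ yes (c , h))

    next : PartialOracle → PartialOracle
    next U x = ⌊ U ∋ x ⊎ New U x ⌋

    open Iteration next (λ x∈U → ⌊⌋-complete (inj₁ x∈U))

    record Sound (U : PartialOracle) : Set where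
      field
        functional : ∀ {χ c c′} → U ∋ (χ , c) → U ∋ (χ , c′) → c ≡ c′
        computes   : ∀ {χ c} → U ∋ (χ , c) → ComputesFrom U c χ

    open Sound

    -- New pairs avoid the old domain, and two new programs for one function are both the choice
    -- made by `em`.
    next-sound : ∀ {U} → Sound U → Sound (next U)
    next-sound {U} s .functional x x′ with ⌊⌋-sound x | ⌊⌋-sound x′
    ... | inj₁ old          | inj₁ old′           = s .functional old old′
    ... | inj₁ old          | inj₂ (undef , _)    = ⊥-elim (undef (_ , old))
    ... | inj₂ (undef , _)  | inj₁ old′           = ⊥-elim (undef (_ , old′))
    ... | inj₂ (_ , _ , eq) | inj₂ (_ , _ , eq′) with refl ← trans (sym eq) eq′ = refl
    next-sound {U} s .computes x with ⌊⌋-sound x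
    ... | inj₁ old         = ComputesFrom-mono (λ x∈U → ⌊⌋-complete (inj₁ x∈U)) (s .computes old)
    ... | inj₂ (_ , h , _) = ComputesFrom-mono (λ x∈U → ⌊⌋-complete (inj₁ x∈U)) h

    -- At a union, `chain` brings two pairs from different stages into a single one.
    tower-sound : ∀ {U} → Tower U → Sound U
    tower-sound (step tower) = next-sound (tower-sound tower)
    tower-sound (union {D} towers) .functional x x′ with ⌊⌋-sound x | ⌊⌋-sound x′
    ... | S , S∈D , x∈S | T , T∈D , x′∈T with chain (towers S S∈D) (towers T T∈D)
    ...   | inj₁ S⊑T = tower-sound (towers T T∈D) .functional (S⊑T x∈S) x′∈T
    ...   | inj₂ T⊑S = tower-sound (towers S S∈D) .functional x∈S (T⊑S x′∈T)
    tower-sound (union {D} towers) .computes x with S , S∈D , x∈S ← ⌊⌋-sound x =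
      ComputesFrom-mono (∈⇒⊑⋃ {D = D} S∈D) (tower-sound (towers S S∈D) .computes x∈S)

    top-sound : Sound top
    top-sound = tower-sound top-tower

    top-closed : ∀ {χ} → Computable top χ → Defined top χ
    top-closed {χ} computable with em {Defined top χ}
    ... | yes defined = defined
    ... | no undef with em {Computable top χ} in eq
    ...   | yes (c , h)     = c , top-fixed (⌊⌋-complete (inj₂ (undef , h , eq)))
    ...   | no uncomputable = ⊥-elim (uncomputable computable)

    oracle : Tp 2
    oracle χ with em {Defined top χ}
    ... | yes (c , _) = suc c
    -- An arbitrary default makes the oracle total.
    ... | no _        = 0

    oracle-extends : oracle Extends top
    oracle-extends {χ} x with em {Defined top χ}
    ... | yes (_ , x′) = cong suc (top-sound .functional x′ x)
    ... | no undef     = ⊥-elim (undef (_ , x))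

    -- By determinism, a program run on one total extension computes at most one function.
    top-injective : ∀ {χ χ′ c} → top ∋ (χ , c) → top ∋ (χ′ , c) → χ ≡ χ′
    top-injective x x′
      with _ , d , t , refl , comp ← top-sound .computes x
         | _ , d′ , t′ , eq , comp′ ← top-sound .computes x′
      with refl , refl ← code-injective d d′ t t′ eq
      = ext λ n → Comp-deterministic ext (comp oracle oracle-extends n)
                                         (comp′ oracle oracle-extends n)

    -- Independence of the total extension

    -- The queries made in a computation are computed by its subcomputations,
    -- so by induction they lie in the domain of top.
    transfer : ∀ {G G′} → G Extends top → G′ Extends top →
               ∀ {σ e y} (t : All Arg σ) → Comp σ e (⟦ t ⟧* G) y → Comp σ e (⟦ t ⟧* G′) y
    transfer {G} extends extends′ t c = go c t refl extends′
      where
      -- `G′` varies within the induction, since closure of `top` needs a query computed from every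
      -- extension.
      go : ∀ {σ e as y} → Comp σ e as y → (t : All Arg σ) → as ≡ ⟦ t ⟧* G →
           ∀ {G′} → G′ Extends top → Comp σ e (⟦ t ⟧* G′) y
      go (S1 x as) (num _ ∷ t) refl ext′ = S1 x _
      go (S2 q as) t refl ext′ = S2 q _
      go (S3 x as) (num _ ∷ t) refl ext′ = S3 x _
      go (S4 {e = e} {d} {x} a b) t refl ext′ =
        S4 {e = e} {d} (go a t refl ext′) (go b (num x ∷ t) refl ext′)
      go (S5-zero {e = e} {d} a) (num _ ∷ t) refl ext′ = S5-zero {e = e} {d} (go a t refl ext′)
      go (S5-suc {e = e} {d} {x} {y} a b) (num _ ∷ t) refl ext′ =
        S5-suc {e = e} {d} (go a (num x ∷ t) refl ext′) (go b (num x ∷ num y ∷ t) refl ext′)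
      go (S6 {e = e} {y} p a) t refl ext′ =
        S6 {e = e} p (subst (λ as → Comp _ e as y) (sym (move p t))
          (go a (All.lookup t p ∷ ─⁺ p t) (move p t) ext′))
        where
        move : ∀ {k σ H} (p : k ∈ σ) (t : All Arg σ) →
               All.lookup (⟦ t ⟧* H) p ∷ ─⁺ p (⟦ t ⟧* H) ≡ ⟦ All.lookup t p ∷ ─⁺ p t ⟧* H
        move p t = cong₂ _∷_ (lookup-map t p) (map-─⁺ _ t p)
      -- No `Arg` has type 1.
      go (S7 f x as) (() ∷ t) eq ext′
      go (S8 {d = d} χ a) (fix ∷ t) refl ext′ =
        S8 {d = d} χ λ ξ → go (a ξ) (num ξ ∷ fix ∷ t) refl ext′
      go (S8 {d = d} χ a) (var ∷ t) refl {G′} ext′ =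
        subst (Comp _ _ _) agree (S8 {d = d} χ λ ξ → go (a ξ) (num ξ ∷ var ∷ t) refl ext′)
        where
        -- The subcomputations of the query, with `var` as a parameter, form a program for `χ`.
        defined : Defined top χ
        defined = top-closed (_ , _ , d , var ∷ t , refl ,
                              λ H extH ξ → go (a ξ) (num ξ ∷ var ∷ t) refl extH)

        agree : G′ χ ≡ G χ
        agree = trans (ext′ (proj₂ defined)) (sym (extends (proj₂ defined)))
      go (S9 {m = m} m≤ a) (num _ ∷ t) refl ext′ =
        S9 {m = m} m≤ (subst (λ as → Comp _ _ as _) (sym (map-take⁺ _ t m))
          (go a (take⁺ m t) (map-take⁺ _ t m) ext′))

    -- Computing from `oracle` alone suffices, since `transfer` carries the computation to every
    -- extension.
    computable⇒defined : ∀ {σ d χ} (t : All Arg σ) →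
                         (∀ n → Comp (0 ∷ σ) d (n ∷ ⟦ t ⟧* oracle) (χ n)) → Defined top χ
    computable⇒defined t comp = top-closed (_ , _ , _ , t , refl ,
      λ G extends n → transfer oracle-extends extends (num n ∷ t) (comp n))

    -- The diagonal function

    flip : ℕ → ℕ
    flip zero    = 1
    flip (suc _) = 0

    flip<2 : ∀ n → flip n < 2
    flip<2 zero    = s≤s (s≤s z≤n)
    flip<2 (suc _) = s≤s z≤n

    flip≢ : ∀ n → flip n ≢ n
    flip≢ zero    ()
    flip≢ (suc _) ()

    diagonal : Tp 1
    diagonal c with em {∃ λ χ → top ∋ (χ , c)}
    ... | yes (χ , _) = flip (χ c)
    ... | no _        = 0

    diagonal-binary : Binary diagonal
    diagonal-binary c with em {∃ λ χ → top ∋ (χ , c)}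
    ... | yes (χ , _) = flip<2 (χ c)
    ... | no _        = s≤s z≤n

    -- The function that `em` picks for `c` is `χ` itself, by `top-injective`.
    diagonal-flips : ∀ {χ c} → top ∋ (χ , c) → diagonal c ≡ flip (χ c)
    diagonal-flips {χ} {c} x with em {∃ λ χ → top ∋ (χ , c)}
    ... | yes (_ , x′) = cong (λ χ → flip (χ c)) (top-injective x′ x)
    ... | no none      = ⊥-elim (none (χ , x))

    diagonal-uncovered : ∀ {χ} → Defined top χ → ¬ (diagonal ∈[ bar χ (oracle χ) ])
    diagonal-uncovered {χ} (c , x) covered =
      flip≢ (χ c) (trans (sym (diagonal-flips x))
        -- The neighbourhood has length `suc c`, so `c` is its last position.
        (∈[bar]⇒agree {diagonal} {χ} (suc c)
          (subst (λ N → diagonal ∈[ bar χ N ]) (oracle-extends x) covered)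
          (n<1+n c)))

    -- Fixing the position in the coded map leaves a program for one entry; position 0 holds the
    -- length, hence `suc i`.
    entry-defined : ∀ {Θ} → ComputableIn {ρ = 2 ∷ []} (codedMap Θ) (E ∷ []) →
                    ∀ {g} → g ∈ Θ oracle → Defined top g
    entry-defined (e , comp) {g} g∈Θ with i , eq ← seqMap-∈ g∈Θ =
      -- Two uses of S6 turn (n, G, i, E) into (i, n, G, E) and then (G, i, n, E).
      computable⇒defined (var ∷ num (suc i) ∷ fix ∷ [])
        λ n → S6 {e = ⟨ 6 ∷ e ∷ 2 ∷ [] ⟩} (there (there (here refl)))
          (S6 {e = e} (there (there (here refl)))
          (subst (Comp _ e _) (eq n) (comp (oracle ∷ suc i ∷ n ∷ []))))

    no-computable-SFF : ¬ (Σ[ Θ ∈ (Tp 2 → List (Tp 1)) ]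
                             (SFF Θ × ComputableIn {ρ = 2 ∷ []} (codedMap Θ) (E ∷ [])))
    no-computable-SFF (Θ , sff , computable)
      with g , g∈Θ , covered ← sff oracle diagonal diagonal-binary
      = diagonal-uncovered (entry-defined computable g∈Θ) covered

theorem3p7 : (∀ ℓ → ExcludedMiddle ℓ) →
    (∀ a b → Extensionality a b) →
    ∀ (E : Tp 2) → Is∃² E →
    ¬ (Σ[ Θ ∈ (Tp 2 → List (Tp 1)) ]
    (SFF Θ × ComputableIn {ρ = 2 ∷ []} (codedMap Θ) (E ∷ [])))
theorem3p7 em ext E _ = Classical.no-computable-SFF (em 0ℓ) (ext 0ℓ 0ℓ) E
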